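{- Let $n\ge 4$ and let $G$ be the complete sun graph on $2n$ vertices. Then for every integer $r\ge 3$, the $r$-th power of $G$ satisfies $\varphi(G^r)=(n-1)(2n-1)$.
   Context: All graphs are finite, simple and without isolated vertices. $\mathbb{N}_0$ denotes the set of non-negative integers; for finite $A,B\subseteq\mathbb{N}_0$, $A+B=\{a+b: a\in A, b\in B\}$. An integer additive set-indexer (IASI) of a graph $G$ is an injective map $f$ from $V(G)$ to the finite non-empty subsets of $\mathbb{N}_0$ such that the induced edge map $f^+(uv)=f(u)+f(v)$ is injective on $E(G)$. A weak IASI (WIASI) is an IASI $f$ with $|f^+(uv)|=\max(|f(u)|,|f(v)|)$ for every edge $uv$ (equivalently, for every edge at least one end vertex has a singleton label). A vertex or edge is mono-indexed if its set-label has cardinality $1$. Every graph admits a WIASI. The sparing number $\varphi(G)$ is the minimum, over all WIASIs of $G$, of the number of mono-indexed edges of $G$. The $r$-th power $G^r$ has vertex set $V(G)$, two distinct vertices being adjacent iff their distance in $G$ is at most $r$. The complete sun graph on $2n$ vertices ($n\ge 3$) has vertex set $U\cup W$ with $U=\{u_1,\dots,u_n\}$, $W=\{w_1,\dots,w_n\}$, where $U$ induces a complete graph, $W$ is an independent set, and $w_j$ is adjacent to $u_i$ if and only if $j=i$ or $j\equiv i+1 \pmod n$. -}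

module Defs where

open import Data.Empty using (⊥)
open import Data.Fin.Base as Fin using (Fin; toℕ)
import Data.Fin.Properties as Fin
open import Data.List.Base
  using (List; []; map; filter; length; deduplicate; allFin; cartesianProduct; cartesianProductWith)
open import Data.List.Relation.Binary.BagAndSetEquality using (_∼[_]_; set)
open import Data.Nat.Base using (ℕ; zero; suc; _+_; _≤_; _<_; _⊔_; ∣_-_∣; s≤s; s≤s⁻¹)
open import Data.Nat.Divisibility using (_∣_; _∣?_)
import Data.Nat.Properties as ℕ
open import Data.Product.Base using (∃; ∃-syntax; _×_; _,_)
open import Data.Sum.Base using (_⊎_; inj₁; inj₂)
open import Function.Base using (_∘_)
open import Function.Bundles using (_↔_; Inverse)
open import Function.Properties.Inverse using (↔-sym; Inverse⇒Injection)
open import Relation.Binary.Definitions using (DecidableEquality)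
open import Relation.Binary.PropositionalEquality using (_≡_; _≢_; refl; sym; subst)
open import Relation.Nullary.Decidable using (Dec; no; map′; _×-dec_; _⊎-dec_; ¬?; via-injection)
open import Relation.Nullary.Negation using (¬_)

------------------------------------------------------------------------
-- Finite simple graphs

record Graph : Set₁ where
  field
    V          : Set
    order      : ℕ
    V↔Fin      : V ↔ Fin order
    Adj        : V → V → Set
    adj?       : ∀ u v → Dec (Adj u v)
    Adj-sym    : ∀ {u v} → Adj u v → Adj v u
    Adj-irrefl : ∀ {v} → ¬ Adj v v

  index : V → Fin order
  index = Inverse.to V↔Fin

  vertex : Fin order → V
  vertex = Inverse.from V↔Fin

  _≟_ : DecidableEquality V
  _≟_ = via-injection (Inverse⇒Injection V↔Fin) Fin._≟_

  vertices : List V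
  vertices = map vertex (allFin order)

  -- Every edge is listed exactly once, as the pair (u , v) of its end
  -- vertices with index u < index v.
  edges : List (V × V)
  edges = filter (λ (u , v) → (index u Fin.<? index v) ×-dec adj? u v)
                 (cartesianProduct vertices vertices)

  any-vertex? : {P : V → Set} → (∀ v → Dec (P v)) → Dec (∃ P)
  any-vertex? {P} P? = map′
    (λ (i , p) → vertex i , p)
    (λ (v , p) → index v , subst P (sym (Inverse.strictlyInverseʳ V↔Fin v)) p)
    (Fin.any? (P? ∘ vertex))

  data Walk : ℕ → V → V → Set where
    stop : ∀ {v} → Walk 0 v v
    step : ∀ {k u v w} → Adj u v → Walk k v w → Walk (suc k) u w

  walk? : ∀ k u v → Dec (Walk k u v)
  walk? zero    u v = map′ (λ { refl → stop }) (λ { stop → refl }) (u ≟ v)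
  walk? (suc k) u v = map′
    (λ (_ , a , p) → step a p)
    (λ { (step a p) → _ , a , p })
    (any-vertex? (λ w → adj? u w ×-dec walk? k w v))

  snoc : ∀ {k u v w} → Walk k u v → Adj v w → Walk (suc k) u w
  snoc stop       a = step a stop
  snoc (step b p) a = step b (snoc p a)

  reverse : ∀ {k u v} → Walk k u v → Walk k v u
  reverse stop       = stop
  reverse (step a p) = snoc (reverse p) (Adj-sym a)

  IsDistance : V → V → ℕ → Set
  IsDistance u v d = Walk d u v × (∀ {k} → k < d → ¬ Walk k u v)

  isDistance? : ∀ u v d → Dec (IsDistance u v d)
  isDistance? u v d = walk? d u v ×-dec ℕ.allUpTo? (λ k → ¬? (walk? k u v)) d

  DistanceAtMost : V → V → ℕ → Set
  DistanceAtMost u v r = ∃[ d ] d ≤ r × IsDistance u v d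

  distanceAtMost? : ∀ u v r → Dec (DistanceAtMost u v r)
  distanceAtMost? u v r = map′
    (λ (d , d<1+r , p) → d , s≤s⁻¹ d<1+r , p)
    (λ (d , d≤r , p) → d , s≤s d≤r , p)
    (ℕ.anyUpTo? (isDistance? u v) (suc r))

-- The r-th power of a graph.

_^ᴳ_ : Graph → ℕ → Graph
G ^ᴳ r = record
  { V          = V
  ; order      = order
  ; V↔Fin      = V↔Fin
  ; Adj        = λ u v → u ≢ v × DistanceAtMost u v r
  ; adj?       = λ u v → ¬? (u ≟ v) ×-dec distanceAtMost? u v r
  ; Adj-sym    = λ (u≢v , d , d≤r , p , min) →
      (u≢v ∘ sym) , d , d≤r , reverse p , (λ k<d → min k<d ∘ reverse)
  ; Adj-irrefl = λ (v≢v , _) → v≢v refl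
  }
  where open Graph G

------------------------------------------------------------------------
-- The complete sun graph on 2n vertices: inj₁ i is u_i and inj₂ j is w_j.
-- Indices are taken from 0, …, n-1, which does not affect the relation
-- j ≡ i + 1 (mod n).

infix 4 _≡ₘ_[mod_]

_≡ₘ_[mod_] : ℕ → ℕ → ℕ → Set
a ≡ₘ b [mod n ] = n ∣ ∣ a - b ∣

module _ {n : ℕ} where

  Incident : Fin n → Fin n → Set
  Incident i j = j ≡ i ⊎ toℕ j ≡ₘ toℕ i + 1 [mod n ]

  incident? : ∀ i j → Dec (Incident i j)
  incident? i j = (j Fin.≟ i) ⊎-dec (n ∣? ∣ toℕ j - (toℕ i + 1) ∣)

  SunAdj : Fin n ⊎ Fin n → Fin n ⊎ Fin n → Set
  SunAdj (inj₁ i) (inj₁ k) = i ≢ k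
  SunAdj (inj₁ i) (inj₂ j) = Incident i j
  SunAdj (inj₂ j) (inj₁ i) = Incident i j
  SunAdj (inj₂ _) (inj₂ _) = ⊥

  sunAdj? : ∀ x y → Dec (SunAdj x y)
  sunAdj? (inj₁ i) (inj₁ k) = ¬? (i Fin.≟ k)
  sunAdj? (inj₁ i) (inj₂ j) = incident? i j
  sunAdj? (inj₂ j) (inj₁ i) = incident? i j
  sunAdj? (inj₂ _) (inj₂ _) = no λ ()

  SunAdj-sym : ∀ x y → SunAdj x y → SunAdj y x
  SunAdj-sym (inj₁ _) (inj₁ _) i≢k = i≢k ∘ sym
  SunAdj-sym (inj₁ _) (inj₂ _) a   = a
  SunAdj-sym (inj₂ _) (inj₁ _) a   = a

  SunAdj-irrefl : ∀ x → ¬ SunAdj x x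
  SunAdj-irrefl (inj₁ _) i≢i = i≢i refl

completeSun : ℕ → Graph
completeSun n = record
  { V          = Fin n ⊎ Fin n
  ; order      = n + n
  ; V↔Fin      = ↔-sym Fin.+↔⊎
  ; Adj        = SunAdj
  ; adj?       = sunAdj?
  ; Adj-sym    = λ {x} {y} → SunAdj-sym x y
  ; Adj-irrefl = λ {x} → SunAdj-irrefl x
  }

-- Graphs are conventionally assumed to have no isolated vertices.  This is
-- not a field of Graph; the lemmas show that it holds for the complete sun
-- graphs and their positive powers.

NoIsolatedVertices : Graph → Set
NoIsolatedVertices G = ∀ u → ∃[ v ] Adj u v
  where open Graph G

completeSun-noIsolated : ∀ n → NoIsolatedVertices (completeSun n)
completeSun-noIsolated n (inj₁ i) = inj₂ i , inj₁ refl
completeSun-noIsolated n (inj₂ j) = inj₁ j , inj₁ refl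

^ᴳ-noIsolated : ∀ G {r} → 1 ≤ r → NoIsolatedVertices G → NoIsolatedVertices (G ^ᴳ r)
^ᴳ-noIsolated G 1≤r h u with h u
... | v , a = v , u≢v , 1 , 1≤r , step a stop , λ { (s≤s _) stop → u≢v refl }
  where
  open Graph G
  u≢v : u ≢ v
  u≢v refl = Adj-irrefl a

------------------------------------------------------------------------
-- Finite subsets of ℕ, represented by lists of their elements.  Order and
-- repetitions are irrelevant: equality is set equality of lists, and the
-- cardinality counts distinct elements.

FinSet : Set
FinSet = List ℕ

infix  4 _≈_
infixl 6 _⊕_

_≈_ : FinSet → FinSet → Set
A ≈ B = A ∼[ set ] B

card : FinSet → ℕ
card A = length (deduplicate ℕ._≟_ A)

_⊕_ : FinSet → FinSet → FinSet
_⊕_ = cartesianProductWith _+_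

------------------------------------------------------------------------
-- Integer additive set-indexers and the sparing number

module _ (G : Graph) where
  open Graph G

  record IsIASI (f : V → FinSet) : Set where
    field
      nonEmpty       : ∀ v → f v ≢ []
      injective      : ∀ {u v} → f u ≈ f v → u ≡ v
      -- Edges are unordered pairs.
      edge-injective : ∀ {u v x y} → Adj u v → Adj x y →
                       f u ⊕ f v ≈ f x ⊕ f y →
                       (u ≡ x × v ≡ y) ⊎ (u ≡ y × v ≡ x)

  record IsWIASI (f : V → FinSet) : Set where
    field
      isIASI : IsIASI f
      weak   : ∀ {u v} → Adj u v → card (f u ⊕ f v) ≡ card (f u) ⊔ card (f v)

  monoIndexedEdges : (V → FinSet) → List (V × V)
  monoIndexedEdges f = filter (λ (u , v) → card (f u ⊕ f v) ℕ.≟ 1) edges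

  -- IsSparingNumber k says that φ(G) = k, the minimum being attained.
  IsSparingNumber : ℕ → Set
  IsSparingNumber k =
    (∃[ f ] IsWIASI f × length (monoIndexedEdges f) ≡ k) ×
    (∀ f → IsWIASI f → k ≤ length (monoIndexedEdges f))

{-# OPTIONS --safe #-}

-- The complete sun graph has diameter at most 3, so its r-th power is the
-- complete graph on 2n vertices as soon as r ≥ 3.  In a complete graph a weak
-- IASI has at most one vertex whose label is not a singleton, because
-- |A + B| > max(|A|, |B|) when A and B both have at least two elements.  All
-- edges avoiding that vertex are mono-indexed, and there are C(2n - 1, 2) of
-- them.  The bound is attained by labelling vertex number i with {2^i}, apart
-- from one vertex that gets {2^i, 2^i + 1}.

module Submission where

open import Data.Fin.Base as Fin using (Fin; zero; suc; toℕ; punchIn)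
import Data.Fin.Properties as Fin
open import Data.List.Base
  using (List; []; _∷_; _++_; map; length; deduplicate; allFin; cartesianProduct)
open import Data.List.Extrema.Nat using (max; argmax-sel; xs≤max; ⊥≤max)
open import Data.List.Membership.Propositional using (_∈_)
open import Data.List.Membership.Propositional.Properties
open import Data.List.Properties using (length-map; length-++; length-tabulate; filter-accept)
open import Data.List.Relation.Binary.Subset.Propositional using (_⊆_)
open import Data.List.Relation.Unary.All as All using ([]; _∷_)
import Data.List.Relation.Unary.All.Properties as All
open import Data.List.Relation.Unary.Any using (here; there)
open import Data.List.Relation.Unary.Unique.DecPropositional.Properties using (deduplicate-!)
open import Data.List.Relation.Unary.Unique.Propositional using (Unique; []; _∷_)
import Data.List.Relation.Unary.Unique.Propositional.Properties as Unique
open import Data.Nat.Base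
open import Data.Nat.Combinatorics using (_C_; nC1≡n; nCk+nC[k+1]≡[n+1]C[k+1])
open import Data.Nat.Induction using (<-rec)
import Data.Nat.Properties as ℕ
open import Data.Nat.Tactic.RingSolver using (solve-∀)
open import Data.Product.Base using (∃-syntax; _×_; _,_; proj₁; map₂) renaming (map to ×-map)
open import Data.Product.Properties using (,-injectiveˡ; ,-injectiveʳ)
open import Data.Sum.Base using (_⊎_; inj₁; inj₂; [_,_]′)
open import Function.Base using (_∘_; id)
open import Function.Bundles using (Equivalence; Injection; Inverse)
open import Function.Properties.Inverse using (↔-sym; Inverse⇒Injection)
open import Relation.Binary.Definitions using (tri<; tri≈; tri>)
open import Relation.Binary.PropositionalEquality
open import Relation.Nullary.Decidable using (yes; no; ¬?; decidable-stable)
open import Relation.Nullary.Negation using (¬_; contradiction)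

open import Defs

private variable
  A B : Set
  n   : ℕ

-- Comparing lengths of duplicate-free lists

Unique-⊆⇒length≤ : {xs ys : List A} → Unique xs → xs ⊆ ys → length xs ≤ length ys
Unique-⊆⇒length≤ [] _ = z≤n
-- Deleting one occurrence of `x` from `ys` still leaves every entry of the tail, because `x` does
-- not recur there.
Unique-⊆⇒length≤ {xs = x ∷ xs} (x∉xs ∷ uxs) xs⊆ys with ∈-∃++ (xs⊆ys (here refl))
... | as , bs , refl = begin
  suc (length xs)               ≤⟨ s≤s (Unique-⊆⇒length≤ uxs xs⊆) ⟩
  suc (length (as ++ bs))       ≡⟨ cong suc (length-++ as) ⟩
  suc (length as + length bs)   ≡⟨ ℕ.+-suc (length as) (length bs) ⟨
  length as + suc (length bs)   ≡⟨ length-++ as ⟨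
  length (as ++ x ∷ bs)         ∎
  where
  open ℕ.≤-Reasoning
  xs⊆ : xs ⊆ as ++ bs
  xs⊆ y∈xs with ∈-++⁻ as (xs⊆ys (there y∈xs))
  ... | inj₁ y∈as         = ∈-++⁺ˡ y∈as
  ... | inj₂ (here refl)  = contradiction refl (All.lookup x∉xs y∈xs)
  ... | inj₂ (there y∈bs) = ∈-++⁺ʳ as y∈bs

-- Increasing pairs of elements of Fin n

increasingPairs : ∀ n → List (Fin n × Fin n)
increasingPairs zero    = []
increasingPairs (suc n) =
  map (λ j → zero , suc j) (allFin n) ++ map (×-map suc suc) (increasingPairs n)

-- Pairs starting with `zero` contribute `n C 1` and the shifted pairs `n C 2`, so the recursion of
-- the list is Pascal's rule.
increasingPairs-length : ∀ n → length (increasingPairs n) ≡ n C 2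
increasingPairs-length zero    = refl
increasingPairs-length (suc n) = begin
  length (increasingPairs (suc n))
    ≡⟨ length-++ (map (λ j → zero , suc j) (allFin n)) ⟩
  length (map (λ j → zero {n} , suc j) (allFin n)) + length (map (×-map suc suc) (increasingPairs n))
    ≡⟨ cong₂ _+_ (trans (length-map _ (allFin n)) (length-tabulate id))
                 (trans (length-map _ (increasingPairs n)) (increasingPairs-length n)) ⟩
  n + n C 2      ≡⟨ cong (_+ n C 2) (nC1≡n n) ⟨
  n C 1 + n C 2  ≡⟨ nCk+nC[k+1]≡[n+1]C[k+1] n 1 ⟩
  suc n C 2      ∎
  where open ≡-Reasoning

×-map-injective : {f : A → B} → (∀ {x y} → f x ≡ f y → x ≡ y) →
                  {p q : A × A} → ×-map f f p ≡ ×-map f f q → p ≡ q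
×-map-injective inj eq = cong₂ _,_ (inj (,-injectiveˡ eq)) (inj (,-injectiveʳ eq))

increasingPairs-unique : ∀ n → Unique (increasingPairs n)
increasingPairs-unique zero    = []
increasingPairs-unique (suc n) = Unique.++⁺
  (Unique.map⁺ (Fin.suc-injective ∘ ,-injectiveʳ) (Unique.allFin⁺ n))
  (Unique.map⁺ (×-map-injective Fin.suc-injective) (increasingPairs-unique n))
  λ (p , q) → disjoint p q
  where
  disjoint : ∀ {x} → x ∈ map (λ j → zero , suc j) (allFin n) →
             ¬ x ∈ map (×-map suc suc) (increasingPairs n)
  disjoint p q with ∈-map⁻ _ p | ∈-map⁻ _ q
  ... | _ , _ , refl | _ , _ , ()

∈-increasingPairs⁺ : {i j : Fin n} → i Fin.< j → (i , j) ∈ increasingPairs n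
∈-increasingPairs⁺ {i = zero}  {suc j} _   = ∈-++⁺ˡ (∈-map⁺ _ (∈-allFin j))
∈-increasingPairs⁺ {i = suc i} {suc j} i<j =
  ∈-++⁺ʳ _ (∈-map⁺ (×-map suc suc) (∈-increasingPairs⁺ (s<s⁻¹ i<j)))

∈-increasingPairs⁻ : {i j : Fin n} → (i , j) ∈ increasingPairs n → i Fin.< j
∈-increasingPairs⁻ {suc n} p with ∈-++⁻ (map (λ j → zero , suc j) (allFin n)) p
... | inj₁ q with ∈-map⁻ _ q
...   | _ , _ , refl = z<s
∈-increasingPairs⁻ {suc n} p | inj₂ q with ∈-map⁻ _ q
...   | _ , r , refl = s<s (∈-increasingPairs⁻ r)

-- Increasing pairs avoiding one index

punchIn-mono-< : ∀ i {j k : Fin n} → j Fin.< k → punchIn i j Fin.< punchIn i k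
punchIn-mono-< i {j} {k} j<k = ℕ.≰⇒> (ℕ.<⇒≱ j<k ∘ Fin.punchIn-cancel-≤ i k j)

punchIn-cancel-< : ∀ i {j k : Fin n} → punchIn i j Fin.< punchIn i k → j Fin.< k
punchIn-cancel-< i {j} {k} p = ℕ.≰⇒> (ℕ.<⇒≱ p ∘ Fin.punchIn-mono-≤ i k j)

-- `punchIn x` is the order isomorphism onto the indices other than `x`, so length, uniqueness and
-- ordering all carry over from `increasingPairs`.
pairsAvoiding : Fin n → List (Fin n × Fin n)
pairsAvoiding {suc n} x = map (×-map (punchIn x) (punchIn x)) (increasingPairs n)

pairsAvoiding-length : (x : Fin n) → length (pairsAvoiding x) ≡ (n ∸ 1) C 2
pairsAvoiding-length {suc n} x =
  trans (length-map _ (increasingPairs n)) (increasingPairs-length n)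

pairsAvoiding-unique : (x : Fin n) → Unique (pairsAvoiding x)
pairsAvoiding-unique {suc n} x =
  Unique.map⁺ (×-map-injective (Fin.punchIn-injective x _ _)) (increasingPairs-unique n)

∈-pairsAvoiding⁺ : {x i j : Fin n} → x ≢ i → x ≢ j → i Fin.< j → (i , j) ∈ pairsAvoiding x
∈-pairsAvoiding⁺ {suc n} {x} x≢i x≢j i<j =
  subst (_∈ pairsAvoiding x) (cong₂ _,_ eqi eqj)
    (∈-map⁺ _ (∈-increasingPairs⁺ (punchIn-cancel-< x
      (subst₂ Fin._<_ (sym eqi) (sym eqj) i<j))))
  where
  eqi = Fin.punchIn-punchOut x≢i
  eqj = Fin.punchIn-punchOut x≢j

∈-pairsAvoiding⁻ : {x i j : Fin n} → (i , j) ∈ pairsAvoiding x → x ≢ i × x ≢ j × i Fin.< j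
∈-pairsAvoiding⁻ {suc n} {x} p with ∈-map⁻ _ p
... | (i , j) , q , refl =
  Fin.punchInᵢ≢i x i ∘ sym , Fin.punchInᵢ≢i x j ∘ sym , punchIn-mono-< x (∈-increasingPairs⁻ q)

-- Cardinalities of sumsets

Unique-⊆⇒length≤card : {xs A : FinSet} → Unique xs → xs ⊆ A → length xs ≤ card A
Unique-⊆⇒length≤card u xs⊆A = Unique-⊆⇒length≤ u (∈-deduplicate⁺ ℕ._≟_ ∘ xs⊆A)

∈-⊕⁺ : ∀ {A B a b} → a ∈ A → b ∈ B → a + b ∈ A ⊕ B
∈-⊕⁺ = ∈-cartesianProductWith⁺ _+_

∈-⊕⁻ : ∀ A B {s} → s ∈ A ⊕ B → ∃[ a ] ∃[ b ] a ∈ A × b ∈ B × s ≡ a + b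
∈-⊕⁻ = ∈-cartesianProductWith⁻ _+_

nonEmpty⇒maximum : ∀ {A} → A ≢ [] → ∃[ m ] m ∈ A × (∀ {a} → a ∈ A → a ≤ m)
nonEmpty⇒maximum {[]}     ne = contradiction refl ne
nonEmpty⇒maximum {x ∷ xs} _  = max x xs , max∈ , ≤max
  where
  max∈ : max x xs ∈ x ∷ xs
  max∈ with argmax-sel id x xs
  ... | inj₁ eq = here eq
  ... | inj₂ p  = there p
  ≤max : ∀ {a} → a ∈ x ∷ xs → a ≤ max x xs
  ≤max (here refl) = ⊥≤max x xs
  ≤max (there p)   = All.lookup (xs≤max x xs) p

card≥2⇒∃< : ∀ A → 2 ≤ card A → ∃[ a ] ∃[ b ] a ∈ A × b ∈ A × a < b
-- Abstracting the deduplicated list refines `2≤` as well, which leaves only lists with two leading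
-- entries; uniqueness makes these distinct.
card≥2⇒∃< A 2≤ with deduplicate ℕ._≟_ A | deduplicate-! ℕ._≟_ A | ∈-deduplicate⁻ ℕ._≟_ A
card≥2⇒∃< A (s≤s ()) | _ ∷ [] | _ | _
... | a ∷ b ∷ _ | (a≢b ∷ _) ∷ _ | mem with ℕ.<-cmp a b
...   | tri< a<b _ _ = a , b , mem (here refl) , mem (there (here refl)) , a<b
...   | tri≈ _ a≡b _ = contradiction a≡b a≢b
...   | tri> _ _ b<a = b , a , mem (there (here refl)) , mem (here refl) , b<a

-- For b < b′ in B, the sum max A + b′ lies outside the translate A + b.
card<card-sums : ∀ {A B} C → A ≢ [] → 2 ≤ card B →
                 (∀ {a b} → a ∈ A → b ∈ B → a + b ∈ C) → card A < card C
card<card-sums {A} {B} C A≢[] 2≤B sums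
  with nonEmpty⇒maximum A≢[] | card≥2⇒∃< B 2≤B
... | m , m∈A , A≤m | b , b′ , b∈B , b′∈B , b<b′ = begin
  suc (card A)                                  ≡⟨ cong suc (length-map (_+ b) A′) ⟨
  length (m + b′ ∷ map (_+ b) A′)               ≤⟨ Unique-⊆⇒length≤card
    (All.map⁺ (All.tabulate new) ∷ Unique.map⁺ (ℕ.+-cancelʳ-≡ b _ _) (deduplicate-! ℕ._≟_ A)) sub ⟩
  card C                                        ∎
  where
  open ℕ.≤-Reasoning
  A′ = deduplicate ℕ._≟_ A
  new : ∀ {a} → a ∈ A′ → m + b′ ≢ a + b
  new a∈A′ eq = ℕ.<⇒≢ (ℕ.+-mono-≤-< (A≤m (∈-deduplicate⁻ ℕ._≟_ A a∈A′)) b<b′) (sym eq)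
  sub : m + b′ ∷ map (_+ b) A′ ⊆ C
  sub (here refl) = sums m∈A b′∈B
  sub (there p) with ∈-map⁻ _ p
  ... | a , a∈A′ , refl = sums (∈-deduplicate⁻ ℕ._≟_ A a∈A′) b∈B

card≥2⇒nonEmpty : ∀ {A} → 2 ≤ card A → A ≢ []
card≥2⇒nonEmpty () refl

-- This is the obstruction to weakness: an edge of a weak IASI cannot have two non-singleton ends.
⊔-card<card-⊕ : ∀ A B → 2 ≤ card A → 2 ≤ card B → card A ⊔ card B < card (A ⊕ B)
⊔-card<card-⊕ A B 2≤A 2≤B = ℕ.⊔-lub
  (card<card-sums {A} {B} (A ⊕ B) (card≥2⇒nonEmpty {A} 2≤A) 2≤B ∈-⊕⁺)
  -- The summands exchange roles. Since the target set is a parameter of `card<card-sums`, commuting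
  -- each sum suffices and `B ⊕ A` never appears.
  (card<card-sums {B} {A} (A ⊕ B) (card≥2⇒nonEmpty {B} 2≤B) 2≤A
    λ {b} {a} b∈B a∈A → subst (_∈ A ⊕ B) (ℕ.+-comm a b) (∈-⊕⁺ a∈A b∈B))

nonEmpty∧card≢1⇒card≥2 : ∀ {A} → A ≢ [] → card A ≢ 1 → 2 ≤ card A
nonEmpty∧card≢1⇒card≥2 {[]}    ne _  = contradiction refl ne
nonEmpty∧card≢1⇒card≥2 {_ ∷ _} _  ≢1 = ℕ.≤∧≢⇒< (s≤s z≤n) (≢1 ∘ sym)

card-pair : ∀ a b → a ≢ b → card (a ∷ b ∷ []) ≡ 2
card-pair a b a≢b = cong (suc ∘ length) (filter-accept (¬? ∘ (a ℕ.≟_)) a≢b)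

-- Minima of finite sets

IsMinimum : ℕ → FinSet → Set
IsMinimum m A = m ∈ A × (∀ {a} → a ∈ A → m ≤ a)

IsMinimum-⊕ : ∀ {A B a b} → IsMinimum a A → IsMinimum b B → IsMinimum (a + b) (A ⊕ B)
IsMinimum-⊕ {A} {B} (a∈A , a≤) (b∈B , b≤) = ∈-⊕⁺ a∈A b∈B , bound
  where
  bound : ∀ {s} → s ∈ A ⊕ B → _ ≤ s
  bound p with ∈-⊕⁻ A B p
  ... | _ , _ , a′∈A , b′∈B , refl = ℕ.+-mono-≤ (a≤ a′∈A) (b≤ b′∈B)

-- Minima respect `≈` and, by `IsMinimum-⊕`, add up under `⊕`. Equality of labels or of edge labels
-- thus becomes an equation between numbers.
IsMinimum-unique : ∀ {A B a b} → A ≈ B → IsMinimum a A → IsMinimum b B → a ≡ b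
IsMinimum-unique A≈B (a∈A , a≤) (b∈B , b≤) = ℕ.≤-antisym
  (a≤ (Equivalence.from A≈B b∈B)) (b≤ (Equivalence.to A≈B a∈A))

-- Sums of two distinct powers of two

2^i+2^j<2^k : ∀ {i j k} → i < j → j < k → 2 ^ i + 2 ^ j < 2 ^ k
2^i+2^j<2^k {i} {j} {k} i<j j<k = begin-strict
  2 ^ i + 2 ^ j        <⟨ ℕ.+-monoˡ-< (2 ^ j) (ℕ.^-monoʳ-< 2 (s≤s (s≤s z≤n)) i<j) ⟩
  2 ^ j + 2 ^ j        ≡⟨ cong (2 ^ j +_) (ℕ.+-identityʳ (2 ^ j)) ⟨
  2 ^ suc j            ≤⟨ ℕ.^-monoʳ-≤ 2 j<k ⟩
  2 ^ k                ∎
  where open ℕ.≤-Reasoning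

2^-injective : ∀ {i j} → 2 ^ i ≡ 2 ^ j → i ≡ j
2^-injective {i} {j} eq with ℕ.<-cmp i j
... | tri< i<j _ _ = contradiction eq (ℕ.<⇒≢ (ℕ.^-monoʳ-< 2 (s≤s (s≤s z≤n)) i<j))
... | tri≈ _ i≡j _ = i≡j
... | tri> _ _ j<i = contradiction (sym eq) (ℕ.<⇒≢ (ℕ.^-monoʳ-< 2 (s≤s (s≤s z≤n)) j<i))

-- The sum determines its larger exponent: if `j < l`, the left side is already below `2 ^ l`, and
-- symmetrically. The other exponents then agree by cancellation.
2^-sum-injective-< : ∀ {i j k l} → i < j → k < l → 2 ^ i + 2 ^ j ≡ 2 ^ k + 2 ^ l → i ≡ k × j ≡ l
2^-sum-injective-< {i} {j} {k} {l} i<j k<l eq with ℕ.<-cmp j l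
... | tri< j<l _ _ = contradiction eq
  (ℕ.<⇒≢ (ℕ.<-≤-trans (2^i+2^j<2^k i<j j<l) (ℕ.m≤n+m (2 ^ l) (2 ^ k))))
... | tri≈ _ refl _ = 2^-injective (ℕ.+-cancelʳ-≡ (2 ^ j) (2 ^ i) (2 ^ k) eq) , refl
... | tri> _ _ l<j = contradiction (sym eq)
  (ℕ.<⇒≢ (ℕ.<-≤-trans (2^i+2^j<2^k k<l l<j) (ℕ.m≤n+m (2 ^ j) (2 ^ i))))

-- Sorting both pairs reduces to the ordered case. The two alternatives mirror those of
-- `edge-injective` for unordered edges.
2^-sum-injective : ∀ {i j k l} → i ≢ j → k ≢ l → 2 ^ i + 2 ^ j ≡ 2 ^ k + 2 ^ l →
                   (i ≡ k × j ≡ l) ⊎ (i ≡ l × j ≡ k)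
2^-sum-injective {i} {j} {k} {l} i≢j k≢l eq with ℕ.<-cmp i j | ℕ.<-cmp k l
... | tri≈ _ i≡j _ | _            = contradiction i≡j i≢j
... | tri< _ _ _   | tri≈ _ k≡l _ = contradiction k≡l k≢l
... | tri> _ _ _   | tri≈ _ k≡l _ = contradiction k≡l k≢l
... | tri< i<j _ _ | tri< k<l _ _ = inj₁ (2^-sum-injective-< i<j k<l eq)
... | tri< i<j _ _ | tri> _ _ l<k =
  inj₂ (2^-sum-injective-< i<j l<k (trans eq (ℕ.+-comm (2 ^ k) _)))
... | tri> _ _ j<i | tri< k<l _ _ with 2^-sum-injective-< j<i k<l (trans (ℕ.+-comm (2 ^ j) _) eq)
...   | j≡k , i≡l = inj₂ (i≡l , j≡k)
2^-sum-injective {i} {j} {k} {l} i≢j k≢l eq | tri> _ _ j<i | tri> _ _ l<k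
  with 2^-sum-injective-< j<i l<k (trans (ℕ.+-comm (2 ^ j) _) (trans eq (ℕ.+-comm (2 ^ k) _)))
...   | j≡l , i≡k = inj₁ (i≡k , j≡l)

-- Complete graphs

module _ (G : Graph) where
  open Graph G

  IsComplete : Set
  IsComplete = ∀ {u v} → u ≢ v → Adj u v

  Adj⇒≢ : ∀ {u v} → Adj u v → u ≢ v
  Adj⇒≢ a refl = Adj-irrefl a

  index-injective : ∀ {u v} → index u ≡ index v → u ≡ v
  index-injective = Injection.injective (Inverse⇒Injection V↔Fin)

  vertex-injective : ∀ {i j} → vertex i ≡ vertex j → i ≡ j
  vertex-injective = Injection.injective (Inverse⇒Injection (↔-sym V↔Fin))

  vertex-index : ∀ v → vertex (index v) ≡ v
  vertex-index = Inverse.strictlyInverseʳ V↔Fin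

  index-vertex : ∀ i → index (vertex i) ≡ i
  index-vertex = Inverse.strictlyInverseˡ V↔Fin

  ∈-vertices : ∀ v → v ∈ vertices
  ∈-vertices v = subst (_∈ vertices) (vertex-index v) (∈-map⁺ vertex (∈-allFin (index v)))

  vertices-unique : Unique vertices
  vertices-unique = Unique.map⁺ vertex-injective (Unique.allFin⁺ order)

  module _ (f : V → FinSet) where

    monoIndexedEdges-unique : Unique (monoIndexedEdges G f)
    monoIndexedEdges-unique = Unique.filter⁺ _
      (Unique.filter⁺ _ (Unique.cartesianProduct⁺ vertices-unique vertices-unique))

    ∈-monoIndexedEdges⁺ : ∀ {u v} → index u Fin.< index v → Adj u v →
                          card (f u ⊕ f v) ≡ 1 → (u , v) ∈ monoIndexedEdges G f
    ∈-monoIndexedEdges⁺ {u} {v} u<v a eq = ∈-filter⁺ _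
      (∈-filter⁺ _ (∈-cartesianProduct⁺ (∈-vertices u) (∈-vertices v)) (u<v , a)) eq

    ∈-monoIndexedEdges⁻ : ∀ {u v} → (u , v) ∈ monoIndexedEdges G f →
                          index u Fin.< index v × Adj u v × card (f u ⊕ f v) ≡ 1
    ∈-monoIndexedEdges⁻ p with ∈-filter⁻ (λ (u , v) → card (f u ⊕ f v) ℕ.≟ 1) {xs = edges} p
    ... | q , eq with ∈-filter⁻ _ {xs = cartesianProduct vertices vertices} q
    ...   | _ , u<v , a = u<v , a , eq

  -- In a complete graph these are exactly the edges missing `x`. They are oriented by index as in
  -- `edges`, so that they can be compared with `monoIndexedEdges` by inclusion.
  edgesAvoiding : V → List (V × V)
  edgesAvoiding x = map (×-map vertex vertex) (pairsAvoiding (index x))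

  edgesAvoiding-length : ∀ x → length (edgesAvoiding x) ≡ (order ∸ 1) C 2
  edgesAvoiding-length x =
    trans (length-map _ (pairsAvoiding (index x))) (pairsAvoiding-length (index x))

  edgesAvoiding-unique : ∀ x → Unique (edgesAvoiding x)
  edgesAvoiding-unique x =
    Unique.map⁺ (×-map-injective vertex-injective) (pairsAvoiding-unique (index x))

  ∈-edgesAvoiding⁺ : ∀ {x u v} → x ≢ u → x ≢ v → index u Fin.< index v →
                     (u , v) ∈ edgesAvoiding x
  ∈-edgesAvoiding⁺ {x} {u} {v} x≢u x≢v u<v =
    subst (_∈ edgesAvoiding x) (cong₂ _,_ (vertex-index u) (vertex-index v))
      (∈-map⁺ (×-map vertex vertex)
        (∈-pairsAvoiding⁺ (x≢u ∘ index-injective) (x≢v ∘ index-injective) u<v))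

  ∈-edgesAvoiding⁻ : ∀ {x u v} → (u , v) ∈ edgesAvoiding x →
                     x ≢ u × x ≢ v × index u Fin.< index v
  ∈-edgesAvoiding⁻ {x} p with ∈-map⁻ (×-map vertex vertex) p
  ... | (i , j) , q , refl with ∈-pairsAvoiding⁻ q
  ...   | x≢i , x≢j , i<j =
    (λ { refl → x≢i (index-vertex i) }) ,
    (λ { refl → x≢j (index-vertex j) }) ,
    subst₂ Fin._<_ (sym (index-vertex i)) (sym (index-vertex j)) i<j

  -- Lower bound for complete graphs

  module _ (complete : IsComplete) {f : V → FinSet} (wiasi : IsWIASI G f) where
    open IsWIASI wiasi
    open IsIASI isIASI

    -- Two vertices with non-singleton labels would be adjacent by completeness, and `⊔-card<card-⊕`
    -- would then contradict `weak`.
    ∃-singletonsOffVertex : V → ∃[ x ] (∀ v → x ≢ v → card (f v) ≡ 1)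
    ∃-singletonsOffVertex v₀ with any-vertex? (λ v → ¬? (card (f v) ℕ.≟ 1))
    -- If all labels are singletons, any vertex can play the exceptional one, so `v₀` serves as the
    -- default.
    ... | no  all1      = v₀ , λ v _ → decidable-stable (card (f v) ℕ.≟ 1) (λ ≢1 → all1 (v , ≢1))
    ... | yes (x , x≢1) = x , λ v x≢v → decidable-stable (card (f v) ℕ.≟ 1) λ v≢1 →
      ℕ.<⇒≢ (⊔-card<card-⊕ (f x) (f v)
              (nonEmpty∧card≢1⇒card≥2 (nonEmpty x) x≢1)
              (nonEmpty∧card≢1⇒card≥2 (nonEmpty v) v≢1))
            (sym (weak (complete x≢v)))

    -- Away from the exceptional vertex both ends are singletons, so `weak` gives each edge label
    -- cardinality `1 ⊔ 1`.
    monoIndexedEdges-lowerBound : V → (order ∸ 1) C 2 ≤ length (monoIndexedEdges G f)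
    monoIndexedEdges-lowerBound v₀ with ∃-singletonsOffVertex v₀
    ... | x , singleton = begin
      (order ∸ 1) C 2                ≡⟨ edgesAvoiding-length x ⟨
      length (edgesAvoiding x)       ≤⟨ Unique-⊆⇒length≤ (edgesAvoiding-unique x) mono ⟩
      length (monoIndexedEdges G f)  ∎
      where
      open ℕ.≤-Reasoning
      mono : edgesAvoiding x ⊆ monoIndexedEdges G f
      mono {u , v} p with ∈-edgesAvoiding⁻ p
      ... | x≢u , x≢v , u<v = ∈-monoIndexedEdges⁺ f u<v a
        (trans (weak a) (cong₂ _⊔_ (singleton u x≢u) (singleton v x≢v)))
        where
        a : Adj u v
        a = complete λ { refl → ℕ.<-irrefl refl u<v }

  -- A labelling that attains the bound

  module PowerLabelling (x : V) where

    power : V → ℕ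
    power v = 2 ^ toℕ (index v)

    -- The extra element at `x` lies above the power, so the minimum of every label, including that
    -- of `x`, is still a power of two.
    label : V → FinSet
    label v with x ≟ v
    ... | yes _ = power v ∷ suc (power v) ∷ []
    ... | no  _ = power v ∷ []

    label-minimum : ∀ v → IsMinimum (power v) (label v)
    label-minimum v with x ≟ v
    ... | yes _ = here refl , λ { (here refl) → ℕ.≤-refl ; (there (here refl)) → ℕ.n≤1+n _ }
    ... | no  _ = here refl , λ { (here refl) → ℕ.≤-refl }

    toℕ-index-injective : ∀ {u v} → toℕ (index u) ≡ toℕ (index v) → u ≡ v
    toℕ-index-injective = index-injective ∘ Fin.toℕ-injective

    -- Minima alone separate the labels: they are distinct powers of two on vertices, and sums of
    -- two distinct powers on edges.
    label-isIASI : IsIASI G label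
    label-isIASI = record
      { nonEmpty       = λ v eq → ∉[] (subst (power v ∈_) eq (proj₁ (label-minimum v)))
      ; injective      = λ {u} {v} eq → toℕ-index-injective
          (2^-injective (IsMinimum-unique eq (label-minimum u) (label-minimum v)))
      ; edge-injective = λ {u} {v} {y} {z} a b eq →
          [ inj₁ ∘ ×-map toℕ-index-injective toℕ-index-injective
          , inj₂ ∘ ×-map toℕ-index-injective toℕ-index-injective ]′
          (2^-sum-injective (Adj⇒≢ a ∘ toℕ-index-injective) (Adj⇒≢ b ∘ toℕ-index-injective)
            (IsMinimum-unique eq
              (IsMinimum-⊕ (label-minimum u) (label-minimum v))
              (IsMinimum-⊕ (label-minimum y) (label-minimum z))))
      }

    -- At least one end of an edge differs from `x` and has a singleton label, so the sumset is a
    -- translate of the other label.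
    label-weak : ∀ {u v} → Adj u v → card (label u ⊕ label v) ≡ card (label u) ⊔ card (label v)
    label-weak {u} {v} a with x ≟ u | x ≟ v
    ... | yes refl | yes refl = contradiction a Adj-irrefl
    ... | yes _    | no  _    = trans
      (card-pair (power u + power v) (suc (power u) + power v) (ℕ.1+n≢n ∘ sym))
      (cong (_⊔ 1) (sym (card-pair (power u) (suc (power u)) (ℕ.1+n≢n ∘ sym))))
    ... | no  _    | yes _    = trans
      (card-pair (power u + power v) (power u + suc (power v))
        (ℕ.1+n≢n ∘ sym ∘ ℕ.+-cancelˡ-≡ (power u) _ _))
      (cong (1 ⊔_) (sym (card-pair (power v) (suc (power v)) (ℕ.1+n≢n ∘ sym))))
    ... | no  _    | no  _    = refl

    label-isWIASI : IsWIASI G label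
    label-isWIASI = record { isIASI = label-isIASI ; weak = label-weak }

    card-label-x : card (label x) ≡ 2
    card-label-x with x ≟ x
    ... | yes _  = card-pair (power x) (suc (power x)) (ℕ.1+n≢n ∘ sym)
    ... | no x≢x = contradiction refl x≢x

    -- An edge at `x` has a label of cardinality at least `card (label x)`, which is 2, so every
    -- mono-indexed edge avoids `x`.
    monoIndexedEdges-upperBound : length (monoIndexedEdges G label) ≤ (order ∸ 1) C 2
    monoIndexedEdges-upperBound = begin
      length (monoIndexedEdges G label)  ≤⟨ Unique-⊆⇒length≤ (monoIndexedEdges-unique label) avoid ⟩
      length (edgesAvoiding x)           ≡⟨ edgesAvoiding-length x ⟩
      (order ∸ 1) C 2                    ∎
      where
      open ℕ.≤-Reasoning
      avoid : monoIndexedEdges G label ⊆ edgesAvoiding x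
      avoid {u , v} p with ∈-monoIndexedEdges⁻ label p
      ... | u<v , a , eq = ∈-edgesAvoiding⁺
        (λ { refl → ℕ.<⇒≢ (ℕ.≤-trans (ℕ.≤-reflexive (sym card-label-x))
                             (ℕ.m≤m⊔n (card (label x)) (card (label v)))) 1≡ })
        (λ { refl → ℕ.<⇒≢ (ℕ.≤-trans (ℕ.≤-reflexive (sym card-label-x))
                             (ℕ.m≤n⊔m (card (label u)) (card (label x)))) 1≡ })
        u<v
        where
        1≡ : 1 ≡ card (label u) ⊔ card (label v)
        1≡ = trans (sym eq) (label-weak a)

  sparingNumber-complete : IsComplete → V → IsSparingNumber G ((order ∸ 1) C 2)
  sparingNumber-complete complete x =
    ( label , label-isWIASI
    , ℕ.≤-antisym monoIndexedEdges-upperBound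
                  (monoIndexedEdges-lowerBound complete label-isWIASI x) ) ,
    λ f wiasi → monoIndexedEdges-lowerBound complete wiasi x
    where open PowerLabelling x

  -- Replacing a walk by a shorter one terminates, by well-founded recursion, at a shortest walk.
  -- Hence bounding a distance only takes exhibiting some walk.
  walk⇒distanceAtMost : ∀ {u v} k → Walk k u v → DistanceAtMost u v k
  walk⇒distanceAtMost {u} {v} = <-rec _ shorten
    where
    shorten : ∀ k → (∀ {j} → j < k → Walk j u v → DistanceAtMost u v j) →
              Walk k u v → DistanceAtMost u v k
    shorten k rec w with ℕ.anyUpTo? (λ j → walk? j u v) k
    ... | no  none          = k , ℕ.≤-refl , w , λ j<k w′ → none (_ , j<k , w′)
    ... | yes (j , j<k , w′) =
      map₂ (λ (d≤j , dist) → ℕ.≤-trans d≤j (ℕ.<⇒≤ j<k) , dist) (rec j<k w′)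

-- Diameter of the complete sun graph

module _ {n : ℕ} where
  open Graph (completeSun n)

  -- Every route goes through the clique: an end `inj₂ j` is joined to `inj₁ j`, and distinct clique
  -- vertices are adjacent. Such a walk may be longer than the distance.
  completeSun-walk : ∀ u v → u ≢ v → ∃[ k ] k ≤ 3 × Walk k u v
  completeSun-walk (inj₁ i) (inj₁ j) u≢v =
    1 , s≤s z≤n , step (u≢v ∘ cong inj₁) stop
  completeSun-walk (inj₁ i) (inj₂ j) _ with i Fin.≟ j
  ... | yes refl = 1 , s≤s z≤n , step (inj₁ refl) stop
  ... | no  i≢j  = 2 , s≤s (s≤s z≤n) , step {v = inj₁ j} i≢j (step (inj₁ refl) stop)
  completeSun-walk (inj₂ i) (inj₁ j) _ with i Fin.≟ j
  ... | yes refl = 1 , s≤s z≤n , step (inj₁ refl) stop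
  ... | no  i≢j  = 2 , s≤s (s≤s z≤n) , step {v = inj₁ i} (inj₁ refl) (step i≢j stop)
  completeSun-walk (inj₂ i) (inj₂ j) u≢v =
    3 , ℕ.≤-refl ,
    step {v = inj₁ i} (inj₁ refl) (step {v = inj₁ j} (u≢v ∘ cong inj₂) (step (inj₁ refl) stop))

completeSun-power-complete : ∀ n {r} → 3 ≤ r → IsComplete (completeSun n ^ᴳ r)
completeSun-power-complete n 3≤r {u} {v} u≢v with completeSun-walk u v u≢v
... | k , k≤3 , w with walk⇒distanceAtMost (completeSun n) k w
...   | d , d≤k , dist = u≢v , d , ℕ.≤-trans d≤k (ℕ.≤-trans k≤3 3≤r) , dist

-- Evaluating the binomial coefficient

[1+n]C2 : ∀ n → suc n C 2 ≡ n + n C 2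
[1+n]C2 n = trans (sym (nCk+nC[k+1]≡[n+1]C[k+1] n 1)) (cong (_+ n C 2) (nC1≡n n))

-- With `p` standing for n - 1, the upper index is 2n - 1 and the closed form involves no division.
-- Each induction step raises that index by two, hence the two uses of `[1+n]C2`.
[1+2p]C2 : ∀ p → suc (p + p) C 2 ≡ p * suc (p + p)
[1+2p]C2 zero    = refl
[1+2p]C2 (suc p) = begin
  suc (suc p + suc p) C 2                              ≡⟨ cong (λ m → suc (suc m) C 2) (ℕ.+-suc p p) ⟩
  suc (suc (suc (p + p))) C 2                          ≡⟨ [1+n]C2 (suc (suc (p + p))) ⟩
  suc (suc (p + p)) + suc (suc (p + p)) C 2            ≡⟨ cong (suc (suc (p + p)) +_) ([1+n]C2 (suc (p + p))) ⟩
  suc (suc (p + p)) + (suc (p + p) + suc (p + p) C 2)  ≡⟨ cong (λ c → suc (suc (p + p)) + (suc (p + p) + c)) ([1+2p]C2 p) ⟩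
  suc (suc (p + p)) + (suc (p + p) + p * suc (p + p))  ≡⟨ rearrange p ⟩
  suc p * suc (suc p + suc p)                          ∎
  where
  open ≡-Reasoning
  rearrange : ∀ p → suc (suc (p + p)) + (suc (p + p) + p * suc (p + p)) ≡ suc p * suc (suc p + suc p)
  rearrange = solve-∀

mainTheorem6 : ∀ (n : ℕ) → 4 ≤ n → ∀ (r : ℕ) → 3 ≤ r →
    IsSparingNumber (completeSun n ^ᴳ r) ((n ∸ 1) * (2 * n ∸ 1))
mainTheorem6 (suc p) _ r 3≤r =
  subst (IsSparingNumber (completeSun (suc p) ^ᴳ r)) count
    (sparingNumber-complete (completeSun (suc p) ^ᴳ r)
      -- A clique vertex is chosen to carry the two-element label.
      (completeSun-power-complete (suc p) 3≤r) (inj₁ zero))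
  where
  open ≡-Reasoning
  count : (p + suc p) C 2 ≡ p * (2 * suc p ∸ 1)
  count = begin
    (p + suc p) C 2          ≡⟨ cong (_C 2) (ℕ.+-suc p p) ⟩
    suc (p + p) C 2          ≡⟨ [1+2p]C2 p ⟩
    p * suc (p + p)          ≡⟨ cong (p *_) (ℕ.+-suc p p) ⟨
    -- `2 * suc p ∸ 1` computes to `p + (suc p + 0)`, so only the trailing zero has to be inserted.
    p * (p + suc p)          ≡⟨ cong (λ m → p * (p + m)) (ℕ.+-identityʳ (suc p)) ⟨
    p * (2 * suc p ∸ 1)      ∎
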